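{- Let $\mathcal{C}$ be a class of clause-sets with $\mathcal{VMU} \cap \mathcal{SED} \subseteq \mathcal{C} \subseteq \mathcal{LEAN}$, and let $k \in \mathbb{N}$. Then $\mathrm{minvdeg}(\mathcal{C}_{\delta = k}) = \mathrm{N}(k)$, where $\mathcal{C}_{\delta=k} = \{F \in \mathcal{C} : \delta(F) = k\}$.
   Context: Literals come with a fixed-point-free involution $x \mapsto \overline{x}$; variables are the positive literals. A clause is a finite set $C$ of literals with $C \cap \overline{C} = \emptyset$; a clause-set is a finite set of clauses. For a clause-set $F$: $\mathrm{var}(F)$ its variables, $n(F) = |\mathrm{var}(F)|$, $c(F) = |F|$, $\delta(F) = c(F) - n(F)$; $\mathrm{ld}_F(x)$ is the number of clauses containing literal $x$, $\mathrm{vdeg}_F(v) = \mathrm{ld}_F(v) + \mathrm{ld}_F(\overline{v})$, $\mathrm{minvdeg}(F) = \min_{v \in \mathrm{var}(F)} \mathrm{vdeg}_F(v)$ for $n(F)>0$. For a class $\mathcal{D}$ of clause-sets, $\mathrm{minvdeg}(\mathcal{D}) \in \mathbb{N}_0 \cup \{+\infty\}$ is the supremum of $\mathrm{minvdeg}(F)$ over $F \in \mathcal{D}$ with $n(F) > 0$, and $0$ if there is no such $F$. The surplus $\sigma(F)$ is $\min_{\emptyset \ne V \subseteq \mathrm{var}(F)} (|\{C \in F : \mathrm{var}(C) \cap V \ne \emptyset\}| - |V|)$ for $n(F) > 0$ and $0$ otherwise. A partial assignment is a map $\varphi : V \to \{0,1\}$ on a finite set $V$ of variables ($\varphi(\overline{v})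 = 1-\varphi(v)$); $F$ is satisfiable iff some partial assignment satisfies (makes true some literal of) every clause. An autarky for $F$ is a partial assignment $\varphi$ such that every clause of $F$ containing a literal falsified by $\varphi$ contains a literal satisfied by $\varphi$. $\mathcal{LEAN}$ is the class of clause-sets $F$ having no autarky $\varphi$ with $\mathrm{var}(\varphi) \cap \mathrm{var}(F) \ne \emptyset$. $\mathcal{VMU}$ (variable-minimally unsatisfiable) is the class of unsatisfiable $F$ such that every unsatisfiable $F' \subseteq F$ has $\mathrm{var}(F') = \mathrm{var}(F)$. $\mathcal{SED}$ is the class of clause-sets $F$ with $\sigma(F) = \delta(F)$. $\mathrm{N} : \mathbb{N} \to \mathbb{N}$ is defined by $\mathrm{N}(1) = 2$ and $\mathrm{N}(k) = \max_{i \in \{2,\dots,k\}} \min(2i, \mathrm{N}(k-i+1)+i)$ for $k \ge 2$. -}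

module Defs where

open import Data.Bool.Base using (Bool; true; false; not)
open import Data.Fin.Base using (Fin; zero; suc; toℕ)
open import Data.Fin.Properties using (toℕ<n)
open import Data.Integer.Base as ℤ using (ℤ; _⊖_; 0ℤ)
import Data.Integer.Properties as ℤ
open import Data.List.Base
  using (List; []; _∷_; [_]; _++_; allFin; concatMap; deduplicate; filter; length; map)
import Data.List.Extrema as Extrema
open import Data.List.Extrema.Nat using (min; max)
import Data.List.Membership.DecPropositional as DecMembership
open import Data.List.Membership.Propositional using (_∈_; _∉_)
open import Data.List.Properties using (map-cong)
open import Data.List.Relation.Binary.BagAndSetEquality using (set; _∼[_]_; [_]-Equality)
import Data.List.Relation.Binary.Subset.Setoid as SubsetSetoid
open import Data.List.Relation.Unary.All using (All)
open import Data.List.Relation.Unary.Any using (Any; any?)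
import Data.List.Relation.Unary.Unique.Setoid as UniqueSetoid
open import Data.Nat.Base using (ℕ; zero; suc; _+_; _*_; _∸_; _⊓_; _≤_; _>_; s≤s⁻¹)
open import Data.Nat.Properties using (+-comm; +-∸-assoc)
open import Data.Product.Base using (_×_; _,_; ∃)
open import Data.Vec.Base as Vec using (Vec)
open import Level using (0ℓ)
open import Relation.Binary.Bundles using (Setoid)
import Relation.Binary.Construct.Add.Supremum.NonStrict as AddSupremum
import Relation.Binary.Construct.On as On
open import Relation.Binary.Definitions using (DecidableEquality)
open import Relation.Binary.PropositionalEquality.Core using (_≡_; refl; cong; trans)
import Relation.Nullary.Construct.Add.Supremum as ⁺
open ⁺ using (_⁺)
open import Relation.Nullary.Decidable.Core using (no; map′)
open import Relation.Nullary.Negation.Core using (¬_)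
open import Relation.Unary using (Pred)

-- The supply of variables is infinite: no finite list exhausts it.

record Universe : Set₁ where
  infix 4 _≟_
  field
    Var   : Set
    _≟_   : DecidableEquality Var
    fresh : (vs : List Var) → ∃ λ v → v ∉ vs

-- Every nonempty subset of a repetition-free list occurs exactly once.

nonemptySublists : ∀ {a} {A : Set a} → List A → List (List A)
nonemptySublists []       = []
nonemptySublists (x ∷ xs) =
  [ x ] ∷ map (x ∷_) (nonemptySublists xs) ++ nonemptySublists xs

minimumℕ : List ℕ → ℕ
minimumℕ []       = 0
minimumℕ (x ∷ xs) = min x xs

minimumℤ : List ℤ → ℤ
minimumℤ []       = 0ℤ
minimumℤ (x ∷ xs) = Extrema.min ℤ.≤-totalOrder x xs

infix 4 _≤∞_

_≤∞_ : ℕ ⁺ → ℕ ⁺ → Set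
_≤∞_ = AddSupremum._≤⁺_ _≤_

module ClauseSets (U : Universe) where
  open Universe U

  data Lit : Set where
    pos neg : Var → Lit

  comp : Lit → Lit
  comp (pos v) = neg v
  comp (neg v) = pos v

  var : Lit → Var
  var (pos v) = v
  var (neg v) = v

  _≟ˡ_ : DecidableEquality Lit
  pos v ≟ˡ pos w = map′ (cong pos) (cong var) (v ≟ w)
  pos _ ≟ˡ neg _ = no λ ()
  neg _ ≟ˡ pos _ = no λ ()
  neg v ≟ˡ neg w = map′ (cong neg) (cong var) (v ≟ w)

  open DecMembership _≟_ using () renaming (_∈?_ to _∈ᵛ?_)
  open DecMembership _≟ˡ_ using () renaming (_∈?_ to _∈ˡ?_)

  record Clause : Set where
    field
      lits       : List Lit
      consistent : ∀ {x} → x ∈ lits → comp x ∉ lits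

  open Clause public

  -- A list of literals stands for its set of members, so clauses are compared
  -- only through membership (order, repetitions and proofs are ignored).

  clauseSetoid : Setoid 0ℓ 0ℓ
  clauseSetoid = On.setoid ([ set ]-Equality Lit) lits

  -- The clauses are pairwise different as sets, so list lengths are
  -- cardinalities.

  record ClauseSet : Set where
    field
      clauses  : List Clause
      distinct : UniqueSetoid.Unique clauseSetoid clauses

  open ClauseSet public

  infix 4 _⊆ᶜ_ _≈ᶜ_

  _⊆ᶜ_ : ClauseSet → ClauseSet → Set
  F ⊆ᶜ G = SubsetSetoid._⊆_ clauseSetoid (clauses F) (clauses G)

  _≈ᶜ_ : ClauseSet → ClauseSet → Set
  F ≈ᶜ G = F ⊆ᶜ G × G ⊆ᶜ F

  varsᶜ : Clause → List Var
  varsᶜ C = map var (lits C)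

  vars : ClauseSet → List Var
  vars F = deduplicate _≟_ (concatMap varsᶜ (clauses F))

  n c : ClauseSet → ℕ
  n F = length (vars F)
  c F = length (clauses F)

  δ : ClauseSet → ℤ
  δ F = c F ⊖ n F

  ld : ClauseSet → Lit → ℕ
  ld F x = length (filter (λ C → x ∈ˡ? lits C) (clauses F))

  vdeg : ClauseSet → Var → ℕ
  vdeg F v = ld F (pos v) + ld F (neg v)

  -- Meaningful only for n F > 0.

  minvdeg : ClauseSet → ℕ
  minvdeg F = minimumℕ (map (vdeg F) (vars F))

  -- s is the supremum in ℕ ∪ {+∞} of minvdeg over the members of D having
  -- variables.  If there are none, every element is an upper bound, and the
  -- least one is 0.

  record MinvdegIs {ℓ} (D : Pred ClauseSet ℓ) (s : ℕ ⁺) : Set ℓ where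
    UpperBound : ℕ ⁺ → Set ℓ
    UpperBound t = ∀ F → D F → n F > 0 → ⁺.[ minvdeg F ] ≤∞ t
    field
      upper : UpperBound s
      least : ∀ t → UpperBound t → s ≤∞ t

  clausesMeeting : ClauseSet → List Var → ℕ
  clausesMeeting F V = length (filter (λ C → any? (_∈ᵛ? V) (varsᶜ C)) (clauses F))

  -- If n F = 0 there is no nonempty V, and the value is 0.

  σ : ClauseSet → ℤ
  σ F = minimumℤ (map (λ V → clausesMeeting F V ⊖ length V) (nonemptySublists (vars F)))

  -- A map dom → {0,1}; the values outside dom are irrelevant.

  record PartialAssignment : Set where
    field
      dom : List Var
      val : Var → Bool

  open PartialAssignment public

  value : PartialAssignment → Lit → Bool
  value φ (pos v) = val φ v
  value φ (neg v) = not (val φ v)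

  Satisfiesˡ Falsifiesˡ : PartialAssignment → Lit → Set
  Satisfiesˡ φ x = var x ∈ dom φ × value φ x ≡ true
  Falsifiesˡ φ x = var x ∈ dom φ × value φ x ≡ false

  Satisfiesᶜ FalsifiesSomeᶜ : PartialAssignment → Clause → Set
  Satisfiesᶜ φ C = Any (Satisfiesˡ φ) (lits C)
  FalsifiesSomeᶜ φ C = Any (Falsifiesˡ φ) (lits C)

  Satisfiable Unsatisfiable : ClauseSet → Set
  Satisfiable   F = ∃ λ φ → All (Satisfiesᶜ φ) (clauses F)
  Unsatisfiable F = ¬ Satisfiable F

  Autarky : ClauseSet → PartialAssignment → Set
  Autarky F φ = All (λ C → FalsifiesSomeᶜ φ C → Satisfiesᶜ φ C) (clauses F)

  LEAN : Pred ClauseSet 0ℓ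
  LEAN F = ¬ ∃ λ φ → Autarky F φ × ∃ λ v → v ∈ dom φ × v ∈ vars F

  VMU : Pred ClauseSet 0ℓ
  VMU F = Unsatisfiable F ×
          (∀ F′ → F′ ⊆ᶜ F → Unsatisfiable F′ → vars F′ ∼[ set ] vars F)

  SED : Pred ClauseSet 0ℓ
  SED F = σ F ≡ δ F

-- With k = m + 2, the index j stands for i = j + 2, and the vector holds
-- N (m + 1), …, N 1, whose entry at j is N (k - i + 1).

nextN : ∀ {m} → Vec ℕ (suc m) → ℕ
nextN {m} h = max 0 (map (λ j → let i = 2 + toℕ j in
                                (2 * i) ⊓ (Vec.lookup h j + i))
                         (allFin (suc m)))

valuesN : ∀ m → Vec ℕ (suc m)
valuesN zero    = 2 Vec.∷ Vec.[]
valuesN (suc m) = nextN (valuesN m) Vec.∷ valuesN m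

-- N 0 is a dummy value.

N : ℕ → ℕ
N zero    = 0
N (suc m) = Vec.head (valuesN m)

N-rec : ∀ m → let k = 2 + m in
        N k ≡ max 0 (map (λ j → let i = 2 + toℕ j in
                                (2 * i) ⊓ (N (k ∸ i + 1) + i))
                         (allFin (suc m)))
N-rec m = cong (max 0) (map-cong (λ j → cong (λ x → (2 * (2 + toℕ j)) ⊓ (x + (2 + toℕ j))) (entry j))
                                 (allFin (suc m)))
  where
  lookup-N : ∀ m (j : Fin (suc m)) → Vec.lookup (valuesN m) j ≡ N (suc m ∸ toℕ j)
  lookup-N zero    zero    = refl
  lookup-N (suc m) zero    = refl
  lookup-N (suc m) (suc j) = lookup-N m j

  entry : ∀ j → Vec.lookup (valuesN m) j ≡ N (m ∸ toℕ j + 1)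
  entry j = trans (lookup-N m j)
                  (cong N (trans (+-∸-assoc 1 (s≤s⁻¹ (toℕ<n j))) (+-comm 1 (m ∸ toℕ j))))

{-# OPTIONS --safe #-}

-- Upper bound: in a lean clause-set with deficiency k and n variables, let v have
-- minimal degree and occur e times with its more frequent sign.  Setting v to
-- satisfy these e clauses leaves n - 1 variables and deficiency k - e + 1.  If
-- the result is lean, induction yields a variable of degree at most
-- N(k - e + 1) + e, so the degree of v is at most min(2e, N(k - e + 1) + e).
-- Otherwise there is an autarky.  Its variables have degree > e, as v has, so it
-- touches some remaining clause D.  Changing D to contain v with the frequent
-- sign keeps the clause-set lean and lowers no degree.  This either increases e
-- or adds an occurrence, so it cannot go on forever.  In this argument repeated
-- clauses do no harm.
--
-- Lower bound: choose l with 2^l ≤ k + l and k + l + 2 ≤ 2^(l+1); unfolding the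
-- recursion gives N(k) ≤ k + l.  Take a unit clause {x} together with k + l full
-- clauses over l + 1 variables, among them all 2^l containing ¬x.  A set V of
-- variables other than the whole misses at most the clause {x}, which gives SED;
-- deleting all full clauses leaves at most {x}, which gives VMU.

module Submission where

open import Defs
open import Data.Bool.Base using (Bool; true; false; not)
import Data.Bool.Properties as Bool
open import Data.Fin.Base using (toℕ; fromℕ<)
open import Data.Fin.Properties using (toℕ-fromℕ<; toℕ<n)
open import Data.Integer.Base as ℤ using (+_; _⊖_)
import Data.Integer.Properties as ℤ
open import Data.List.Base using (List; []; _∷_; _++_; allFin; concatMap; filter; length; map; take)
import Data.List.Extrema as Extrema
open import Data.List.Extrema.Nat
  using (max; max≤v⁺; xs≤max; min≤v⁺; v≤min⁺; argmin; argmin-sel; f[argmin]≤f[⊤]; f[argmin]≤f[xs])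
import Data.List.Membership.DecPropositional as DecMembership
open import Data.List.Membership.Propositional using (_∈_; _∉_; find; lose)
open import Data.List.Membership.Propositional.Properties
  using (∈-allFin; ∈-∃++; ∈-filter⁺; ∈-filter⁻; ∈-map⁺; ∈-map⁻; ∈-++⁺ˡ; ∈-++⁺ʳ; ∈-++⁻;
         ∈-concatMap⁺; ∈-concatMap⁻; ∈-deduplicate⁺; ∈-deduplicate⁻)
open import Data.List.Membership.Propositional.Properties.WithK using (unique∧set⇒bag)
open import Data.List.Properties
  using (filter-accept; filter-reject; filter-all; filter-none; filter-some; length-++;
         length-filter; length-map; length-take; map-cong)
open import Data.List.Relation.Binary.BagAndSetEquality using (set; _∼[_]_; ∼bag⇒↭)
open import Data.List.Relation.Binary.Permutation.Propositional using (_↭_; ↭⇒↭ₛ; ↭-sym)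
open import Data.List.Relation.Binary.Permutation.Propositional.Properties
  using (shift; ↭-length; filter-↭; map⁺; All-resp-↭; Any-resp-↭; ∈-resp-↭)
import Data.List.Relation.Binary.Permutation.Setoid.Properties as Permutationₛ
import Data.List.Relation.Binary.Subset.Propositional as List
open import Data.List.Relation.Unary.All as All using (All; []; _∷_)
import Data.List.Relation.Unary.All.Properties as All
open import Data.List.Relation.Unary.AllPairs as AllPairs using (AllPairs; []; _∷_)
import Data.List.Relation.Unary.AllPairs.Properties as AllPairs
open import Data.List.Relation.Unary.Any as Any using (Any; here; there; any?)
import Data.List.Relation.Unary.Unique.DecPropositional.Properties as Unique
open import Data.List.Relation.Unary.Unique.Propositional using (Unique)
open import Data.Maybe.Base using (Maybe; just; nothing; fromMaybe; _<∣>_)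
open import Data.Maybe.Properties using (≡-dec; just-injective)
open import Data.Nat.Base
open import Data.Nat.ListAction using (sum)
open import Data.Nat.ListAction.Properties using (sum-↭)
open import Data.Nat.Properties hiding (_≟_)
open import Data.Nat.Solver using (module +-*-Solver)
open import Data.Product.Base using (_×_; _,_; ∃; ∃₂)
open import Data.Sum.Base using (_⊎_; inj₁; inj₂)
open import Function.Base using (_∘_; id)
open import Function.Bundles using (Equivalence; mk⇔)
import Relation.Binary.Construct.Add.Supremum.NonStrict as AddSupremum
open import Relation.Binary.Definitions using (DecidableEquality; _Respects_)
open import Relation.Binary.PropositionalEquality hiding ([_])
open import Relation.Nullary using (¬_; Dec; yes; no; contradiction)
open import Relation.Nullary.Construct.Add.Supremum using ([_])
open import Relation.Nullary.Decidable using (¬?; _×-dec_; decidable-stable; toSum)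
open import Relation.Unary using (Pred; Decidable; _⊆_; _∩_)
open AddSupremum _≤_ using (≤⁺-trans; [_])

-- Estimates for the recursion defining `N`

-- The term of N-rec for k = 2 + m and i = 2 + t.
splitTerm : ℕ → ℕ → ℕ
splitTerm m t = (2 * (2 + t)) ⊓ (N (m ∸ t + 1) + (2 + t))

N≡max-splitTerm : ∀ m → N (2 + m) ≡ max 0 (map (λ q → splitTerm m (toℕ q)) (allFin (suc m)))
N≡max-splitTerm = N-rec

-- Writing the argument of `N` as `2 + i + j` turns the recursive argument into `suc j`, free of
-- truncated subtraction.
splitTerm≤N : ∀ i j → (2 * (2 + i)) ⊓ (N (suc j) + (2 + i)) ≤ N (2 + i + j)
splitTerm≤N i j = subst₂ _≤_ eq (sym (N≡max-splitTerm (i + j)))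
  (All.lookup (xs≤max 0 _) (∈-map⁺ (λ q → splitTerm (i + j) (toℕ q)) (∈-allFin p)))
  where
  p = fromℕ< {i} {suc (i + j)} (s≤s (m≤m+n i j))
  eq : splitTerm (i + j) (toℕ p) ≡ (2 * (2 + i)) ⊓ (N (suc j) + (2 + i))
  eq rewrite toℕ-fromℕ< (s≤s (m≤m+n i j)) | m+n∸m≡n i j | +-comm j 1 = refl

-- For an argument K ≥ 2, the largest index K of the recursion contributes the minimum of 2K and
-- `N 1` + K, and both exceed K.
N>k : ∀ k → 2 + k ≤ N (suc k)
N>k zero    = ≤-refl
N>k (suc m) = subst (λ x → 3 + m ≤ N (2 + x)) (+-identityʳ m)
  (≤-trans (⊓-glb (≤-trans (s≤s (s≤s (+-monoˡ-≤ m (s≤s z≤n)))) (≤-reflexive (e₁ m))) (n≤1+n _))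
           (splitTerm≤N m 0))
  where
  open +-*-Solver
  e₁ : ∀ m → 2 + (2 + m + 0) + 0 + m ≡ 2 * (2 + m)
  e₁ = solve 1 (λ m → con 2 :+ (con 2 :+ m :+ con 0) :+ con 0 :+ m := con 2 :* (con 2 :+ m)) refl

-- The form needed for a literal occurring i times: making it true takes the deficiency from `i + j`
-- to `suc j`. The recursion has no index 1, but in that case m is at most 2, which is below `N` at
-- every positive argument.
N-split : ∀ {i j m} → 0 < i → m ≤ 2 * i → m ≤ N (suc j) + i → m ≤ N (i + j)
N-split {1}           {j} _ m≤2 _  = ≤-trans m≤2 (≤-trans (s≤s (s≤s z≤n)) (N>k j))
N-split {suc (suc i)} {j} _ m≤2i m≤ = ≤-trans (⊓-glb m≤2i m≤) (splitTerm≤N i j)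

-- Induction on l. A term whose index i has 2i within the bound is settled by the first entry of its
-- minimum. For a larger i the remaining argument is so small that the hypothesis, roughly halved,
-- holds for it with l lowered by one, and the second entry settles the term.
N-upper : ∀ l k → 4 + k + l ≤ 2 ^ (2 + l) → N (suc k) ≤ 2 + k + l
N-upper l       zero    _ = s≤s (s≤s z≤n)
N-upper zero    (suc m) (s≤s (s≤s (s≤s (s≤s ()))))
N-upper (suc l) (suc m) h = subst (_≤ 3 + m + suc l) (sym (N≡max-splitTerm m))
  (max≤v⁺ {xs = map (λ q → splitTerm m (toℕ q)) (allFin (suc m))} z≤n
    (All.map⁺ (All.tabulate λ {q} _ → step (toℕ q) (m ∸ toℕ q) (sym (m+[n∸m]≡n (s≤s⁻¹ (toℕ<n q)))))))
  where
  open +-*-Solver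
  step : ∀ t r → m ≡ t + r → splitTerm m t ≤ 3 + m + suc l
  step t r refl with 2 * (2 + t) ≤? 3 + (t + r) + suc l
  ... | yes 2i≤ = ≤-trans (m⊓n≤m _ _) 2i≤
  ... | no 2i≰ rewrite m+n∸m≡n t r | +-comm r 1 = begin
    (2 * (2 + t)) ⊓ (N (suc r) + (2 + t)) ≤⟨ m⊓n≤n (2 * (2 + t)) _ ⟩
    N (suc r) + (2 + t)                   ≤⟨ +-monoˡ-≤ (2 + t) (N-upper l r 4+r+l≤Q) ⟩
    2 + r + l + (2 + t)                   ≡⟨ e₁ r l t ⟩
    3 + (t + r) + suc l                   ∎
    where
    open ≤-Reasoning
    Q = 2 ^ (2 + l)
    e₁ : ∀ r l t → 2 + r + l + (2 + t) ≡ 3 + (t + r) + suc l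
    e₁ = solve 3 (λ r l t → con 2 :+ r :+ l :+ (con 2 :+ t) := con 3 :+ (t :+ r) :+ (con 1 :+ l)) refl
    e₂ : ∀ r l t → suc (3 + (t + r) + suc l) ≡ 4 + t + (r + suc l)
    e₂ = solve 3 (λ r l t → con 1 :+ (con 3 :+ (t :+ r) :+ (con 1 :+ l)) := con 4 :+ t :+ (r :+ (con 1 :+ l))) refl
    e₃ : ∀ t → 2 * (2 + t) ≡ 4 + t + t
    e₃ = solve 1 (λ t → con 2 :* (con 2 :+ t) := con 4 :+ t :+ t) refl
    e₄ : ∀ r l → suc (2 * (3 + r + l)) ≡ 6 + (r + suc l) + r + l
    e₄ = solve 2 (λ r l → con 1 :+ con 2 :* (con 3 :+ r :+ l) := con 6 :+ (r :+ (con 1 :+ l)) :+ r :+ l) refl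
    e₅ : ∀ r l t → 6 + t + r + l ≡ 5 + (t + r) + suc l
    e₅ = solve 3 (λ r l t → con 6 :+ t :+ r :+ l := con 5 :+ (t :+ r) :+ (con 1 :+ l)) refl
    r+l<t : r + suc l ≤ t
    r+l<t = +-cancelˡ-≤ (4 + t) _ _ (subst₂ _≤_ (e₂ r l t) (e₃ t) (≰⇒> 2i≰))
    4+r+l≤Q : 4 + r + l ≤ Q
    -- Halving `h`: the odd number after `2 * (3 + r + l)` is at most `2 * Q`, which makes the
    -- halved inequality strict.
    4+r+l≤Q = *-cancelˡ-< 2 (3 + r + l) Q (begin-strict
      2 * (3 + r + l)         <⟨ ≤-refl ⟩
      suc (2 * (3 + r + l))   ≡⟨ e₄ r l ⟩
      6 + (r + suc l) + r + l ≤⟨ +-monoˡ-≤ l (+-monoˡ-≤ r (+-monoʳ-≤ 6 r+l<t)) ⟩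
      6 + t + r + l           ≡⟨ e₅ r l t ⟩
      5 + (t + r) + suc l     ≤⟨ h ⟩
      2 * Q                   ∎)

-- Passing from k to `suc k`, the exponent stays as long as the upper inequality survives. When it
-- fails, its failure is exactly the lower inequality for `suc l`.
∃-exponent : ∀ k → ∃ λ l → 2 ^ suc l ≤ 2 + k + l × 4 + k + l ≤ 2 ^ (2 + l)
∃-exponent zero = 0 , ≤-refl , ≤-refl
∃-exponent (suc k) with ∃-exponent k
... | l , lo , hi with 5 + k + l ≤? 2 ^ (2 + l)
...   | yes hi′ = l , ≤-trans lo (n≤1+n _) , hi′
...   | no  ≰hi = suc l , Q≤ , (begin
  4 + suc k + suc l      ≡⟨ cong (λ m → 5 + m) (+-suc k l) ⟩
  2 + (4 + k + l)        ≤⟨ +-mono-≤ 2≤Q hi ⟩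
  Q + Q                  ≡⟨ cong (λ m → Q + m) (+-identityʳ Q) ⟨
  2 * Q                  ∎)
  where
  open ≤-Reasoning
  Q = 2 ^ (2 + l)
  2≤Q : 2 ≤ Q
  2≤Q = ≤-trans (s≤s (s≤s z≤n)) hi
  Q≤ : Q ≤ 2 + suc k + suc l
  Q≤ = subst (Q ≤_) (cong (λ m → 3 + m) (sym (+-suc k l))) (s≤s⁻¹ (≰⇒> ≰hi))

-- Permutations and minima of lists

∈⇒↭ : ∀ {a} {A : Set a} {x : A} {xs} → x ∈ xs → ∃ λ ys → xs ↭ x ∷ ys
∈⇒↭ x∈ with ys , zs , refl ← ∈-∃++ x∈ = ys ++ zs , shift _ ys zs

∃-argmin : ∀ {a} {A : Set a} (f : A → ℕ) x xs →
           ∃ λ v → v ∈ x ∷ xs × All (λ w → f v ≤ f w) (x ∷ xs)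
∃-argmin f x xs =
  argmin f x xs , ∈xs (argmin-sel f x xs) ,
  f[argmin]≤f[⊤] {f = f} x xs ∷ f[argmin]≤f[xs] {f = f} x xs
  where
  ∈xs : argmin f x xs ≡ x ⊎ argmin f x xs ∈ xs → argmin f x xs ∈ x ∷ xs
  ∈xs (inj₁ ≡x)  = here ≡x
  ∈xs (inj₂ ∈xs) = there ∈xs

-- Rows, autarkies and degrees

module Rows {Var : Set} (_≟_ : DecidableEquality Var) where

  -- A row stands for a clause, or for a partial assignment, as the map sending
  -- a variable to the sign with which it occurs.

  Row : Set
  Row = Var → Maybe Bool

  infix 4 _≟ᵐ_

  _≟ᵐ_ : DecidableEquality (Maybe Bool)
  _≟ᵐ_ = ≡-dec Bool._≟_

  Touch Sat : Row → Row → Set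
  Touch φ C = ∃ λ w → φ w ≢ nothing × C w ≢ nothing
  Sat   φ C = ∃₂ λ w b → φ w ≡ just b × C w ≡ just b

  Autarkic : Row → List Row → Set
  Autarkic φ F = ∀ C → C ∈ F → Touch φ C → Sat φ C

  Supported : List Var → Row → Set
  Supported vs φ = ∀ w → φ w ≢ nothing → w ∈ vs

  -- Autarkies live on `vs` only, so dropping a variable from `vs` has the effect of deleting its
  -- literals from all rows. Asking that touched rather than falsified clauses be satisfied is
  -- equivalent, since a touched literal that is not falsified is satisfied.
  HasAutarky Lean : List Var → List Row → Set
  HasAutarky vs F = ∃ λ φ → Supported vs φ × (∃ λ w → φ w ≢ nothing) × Autarkic φ F
  Lean vs F = ¬ HasAutarky vs F

  lean-⊆ : ∀ {vs ws F G} → ws List.⊆ vs → F List.⊆ G → Lean vs F → Lean ws G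
  lean-⊆ ws⊆vs F⊆G lean (φ , supp , non , aut) =
    lean (φ , (λ w φw → ws⊆vs (supp w φw)) , non , λ C C∈ → aut C (F⊆G C∈))

  just≢nothing : ∀ {m : Maybe Bool} {b} → m ≡ just b → m ≢ nothing
  just≢nothing refl ()

  infixl 8 _[_≔_]

  _[_≔_] : Row → Var → Bool → Row
  (C [ v ≔ b ]) w with w ≟ v
  ... | yes _ = just b
  ... | no  _ = C w

  ≔-same : ∀ C v b → (C [ v ≔ b ]) v ≡ just b
  ≔-same C v b with v ≟ v
  ... | yes _   = refl
  ... | no  v≢v = contradiction refl v≢v

  ≔-other : ∀ C {v w} b → w ≢ v → (C [ v ≔ b ]) w ≡ C w
  ≔-other C {v} {w} b w≢v with w ≟ v
  ... | yes w≡v = contradiction w≡v w≢v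
  ... | no  _   = refl

  litDeg : List Row → Var → Bool → ℕ
  litDeg F v b = length (filter (λ C → C v ≟ᵐ just b) F)

  deg : List Row → Var → ℕ
  deg F v = length (filter (λ C → ¬? (C v ≟ᵐ nothing)) F)

  deg-signs : ∀ F v b → deg F v ≡ litDeg F v b + litDeg F v (not b)
  deg-signs []      v b = refl
  deg-signs (C ∷ F) v b with C v
  deg-signs (C ∷ F) v true  | nothing    = deg-signs F v true
  deg-signs (C ∷ F) v false | nothing    = deg-signs F v false
  deg-signs (C ∷ F) v true  | just true  = cong suc (deg-signs F v true)
  deg-signs (C ∷ F) v true  | just false = trans (cong suc (deg-signs F v true)) (sym (+-suc _ _))
  deg-signs (C ∷ F) v false | just true  = trans (cong suc (deg-signs F v false)) (sym (+-suc _ _))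
  deg-signs (C ∷ F) v false | just false = cong suc (deg-signs F v false)

  litDeg-∷-yes : ∀ {F C v b} → C v ≡ just b → litDeg (C ∷ F) v b ≡ suc (litDeg F v b)
  litDeg-∷-yes {F} {C} {v} {b} eq = cong length (filter-accept (λ D → D v ≟ᵐ just b) {C} {F} eq)

  litDeg-∷-no : ∀ {F C v b} → C v ≢ just b → litDeg (C ∷ F) v b ≡ litDeg F v b
  litDeg-∷-no {F} {C} {v} {b} neq = cong length (filter-reject (λ D → D v ≟ᵐ just b) {C} {F} neq)

  deg-∷-occ : ∀ {F C v} → C v ≢ nothing → deg (C ∷ F) v ≡ suc (deg F v)
  deg-∷-occ {F} {C} {v} occ = cong length (filter-accept (λ D → ¬? (D v ≟ᵐ nothing)) {C} {F} occ)

  deg-∷-not : ∀ {F C v} → C v ≡ nothing → deg (C ∷ F) v ≡ deg F v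
  deg-∷-not {F} {C} {v} eq =
    cong length (filter-reject (λ D → ¬? (D v ≟ᵐ nothing)) {C} {F} (λ occ → occ eq))

  deg-∷-cong : ∀ {F C D w} → C w ≡ D w → deg (C ∷ F) w ≡ deg (D ∷ F) w
  deg-∷-cong {D = D} {w} eq rewrite eq with D w ≟ᵐ nothing
  ... | yes _ = refl
  ... | no  _ = refl

  litDeg-↭ : ∀ {F G} v b → F ↭ G → litDeg F v b ≡ litDeg G v b
  litDeg-↭ v b F↭G = ↭-length (filter-↭ (λ C → C v ≟ᵐ just b) F↭G)

  deg-↭ : ∀ {F G} v → F ↭ G → deg F v ≡ deg G v
  deg-↭ v F↭G = ↭-length (filter-↭ (λ C → ¬? (C v ≟ᵐ nothing)) F↭G)

  deg≤length : ∀ F v → deg F v ≤ length F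
  deg≤length F v = length-filter (λ C → ¬? (C v ≟ᵐ nothing)) F

  -- The clauses left by the assignment v ↦ b; the variable v itself is dropped
  -- by removing it from the list of variables under consideration.

  without : Var → Bool → List Row → List Row
  without v b = filter (λ C → ¬? (C v ≟ᵐ just b))

  length-without : ∀ F v b → length (without v b F) + litDeg F v b ≡ length F
  length-without []      v b = refl
  length-without (C ∷ F) v b with C v ≟ᵐ just b
  ... | yes _ = trans (+-suc _ _) (cong suc (length-without F v b))
  ... | no  _ = cong suc (length-without F v b)

  deg-without : ∀ F v b w → deg F w ≤ deg (without v b F) w + litDeg F v b
  deg-without []      v b w = z≤n
  deg-without (C ∷ F) v b w with C v ≟ᵐ just b
  deg-without (C ∷ F) v b w | yes _ with C w ≟ᵐ nothing
  ... | yes _ = ≤-trans (deg-without F v b w) (+-monoʳ-≤ (deg (without v b F) w) (n≤1+n _))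
  ... | no  _ = ≤-trans (s≤s (deg-without F v b w)) (≤-reflexive (sym (+-suc _ _)))
  deg-without (C ∷ F) v b w | no _ with C w ≟ᵐ nothing
  ... | yes _ = deg-without F v b w
  ... | no  _ = s≤s (deg-without F v b w)

  deg≤litDeg : ∀ {F v w b} → (∀ {C} → C ∈ F → C w ≢ nothing → C v ≡ just b) →
               deg F w ≤ litDeg F v b
  deg≤litDeg {F} {v} {w} {b} h = ≤-trans (deg-without F v b w) (+-monoˡ-≤ _ (≤-reflexive deg≡0))
    where
    deg≡0 : deg (without v b F) w ≡ 0
    deg≡0 = cong length (filter-none (λ C → ¬? (C w ≟ᵐ nothing)) (All.tabulate λ C∈ Cw →
      let C∈F , Cv = ∈-filter⁻ (λ C → ¬? (C v ≟ᵐ just b)) C∈ in Cv (h C∈F Cw)))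

  -- If v never occurred with sign b, setting it to `not b` would satisfy every clause touched: the
  -- pure-literal autarky.
  lean⇒litDeg>0 : ∀ {vs F v} → v ∈ vs → Lean vs F → ∀ b → 0 < litDeg F v b
  lean⇒litDeg>0 {vs} {F} {v} v∈ lean b with litDeg F v b in eq
  ... | suc _ = s≤s z≤n
  ... | zero  = contradiction (φ , supp , (v , just≢nothing φv) , aut) lean
    where
    φ : Row
    φ = (λ _ → nothing) [ v ≔ not b ]
    φv : φ v ≡ just (not b)
    φv = ≔-same (λ _ → nothing) v (not b)
    only : ∀ {w} → φ w ≢ nothing → w ≡ v
    only {w} φw with w ≟ v
    ... | yes w≡v = w≡v
    ... | no  _   = contradiction refl φw
    supp : Supported vs φ
    supp w φw with refl ← only φw = v∈
    sign : ∀ {C} → C ∈ F → C v ≢ nothing → C v ≡ just (not b)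
    sign {C} C∈ Cv with C v in Cv≡
    ... | nothing = contradiction refl Cv
    ... | just b′ = cong just (Bool.¬-not λ b′≡b → contradiction
            (subst (0 <_) eq (filter-some (λ C → C v ≟ᵐ just b) (lose C∈ (trans Cv≡ (cong just b′≡b)))))
            λ ())
    aut : Autarkic φ F
    aut C C∈ (w , φw , Cw) with refl ← only φw = v , not b , φv , sign C∈ Cw

  -- The degree bound for lean lists of rows

  -- An autarky ψ of the new clause-set with ψ v ≡ just b, overridden by φ, is an
  -- autarky of the old one; with any other value at v, ψ itself is one.

  lean-≔ : ∀ {v vs F D b φ} → v ∉ vs → Lean (v ∷ vs) (D ∷ F) →
           Supported vs φ → Autarkic φ (without v b (D ∷ F)) → Touch φ D →
           Lean (v ∷ vs) (D [ v ≔ b ] ∷ F)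
  lean-≔ {v} {vs} {F} {D} {b} {φ} v∉ lean φsupp φaut φD (ψ , ψsupp , (u , ψu) , ψaut) =
    lean (≟b (ψ v ≟ᵐ just b))
    where
    D′ : Row
    D′ = D [ v ≔ b ]
    D′v : D′ v ≡ just b
    D′v = ≔-same D v b
    D′≡D : ∀ {w} → w ≢ v → D′ w ≡ D w
    D′≡D = ≔-other D b

    same : ψ v ≢ just b → Autarkic ψ (D ∷ F)
    same ψv≢ C (there C∈F) t = ψaut C (there C∈F) t
    same ψv≢ _ (here refl) (w , ψw , Dw) with ψaut D′ (here refl) touch
      where
      touch : Touch ψ D′
      touch with toSum (w ≟ v)
      ... | inj₁ refl = v , ψw , just≢nothing D′v
      ... | inj₂ w≢v  = w , ψw , λ D′w → Dw (trans (sym (D′≡D w≢v)) D′w)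
    ... | w′ , b′ , ψw′ , D′w′ with toSum (w′ ≟ v)
    ...   | inj₁ refl = contradiction (trans ψw′ (trans (sym D′w′) D′v)) ψv≢
    ...   | inj₂ w′≢v = w′ , b′ , ψw′ , trans (sym (D′≡D w′≢v)) D′w′

    χ : Row
    χ w = φ w <∣> ψ w
    χ-φ : ∀ {w c} → φ w ≡ just c → χ w ≡ just c
    χ-φ eq rewrite eq = refl
    χ-ψ : ∀ {w} → φ w ≡ nothing → χ w ≡ ψ w
    χ-ψ eq rewrite eq = refl
    φv : φ v ≡ nothing
    φv = decidable-stable (φ v ≟ᵐ nothing) (λ occ → v∉ (φsupp v occ))

    χsupp : Supported (v ∷ vs) χ
    χsupp w χw with φ w ≟ᵐ nothing
    ... | yes φw = ψsupp w (λ ψw → χw (trans (χ-ψ φw) ψw))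
    ... | no  φw = there (φsupp w φw)

    χaut : ψ v ≡ just b → Autarkic χ (D ∷ F)
    χaut ψv C C∈ (w , χw , Cw) with C v ≟ᵐ just b
    ... | yes Cv = v , b , trans (χ-ψ φv) ψv , Cv
    ... | no  Cv = go C∈
      where
      φ-sat : Touch φ C → Sat χ C
      φ-sat t with φaut C (∈-filter⁺ (λ C → ¬? (C v ≟ᵐ just b)) C∈ Cv) t
      ... | w′ , b′ , φw′ , Cw′ = w′ , b′ , χ-φ φw′ , Cw′
      go : C ∈ D ∷ F → Sat χ C
      -- The autarky ψ concerns the changed clause and says nothing useful about `D` itself, but φ
      -- touches `D` and so satisfies it.
      go (here refl) = φ-sat φD
      go (there C∈F) with φ w ≟ᵐ nothing
      ... | no  φw = φ-sat (w , φw , Cw)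
      ... | yes φw with ψaut C (there C∈F) (w , (λ ψw → χw (trans (χ-ψ φw) ψw)) , Cw)
      ...   | w′ , b′ , ψw′ , Cw′ with φ w′ ≟ᵐ nothing
      -- Here φ may have overridden the literal by which ψ satisfies the clause; then φ touches the
      -- clause and satisfies it instead.
      ...     | no  φw′ = φ-sat (w′ , φw′ , just≢nothing Cw′)
      ...     | yes φw′ = w′ , b′ , trans (χ-ψ φw′) ψw′ , Cw′

    ≟b : Dec (ψ v ≡ just b) → HasAutarky (v ∷ vs) (D ∷ F)
    ≟b (no  ψv≢) = ψ , ψsupp , (u , ψu) , same ψv≢
    ≟b (yes ψv)  = χ , χsupp , (v , just≢nothing (trans (χ-ψ φv) ψv)) , χaut ψv

  -- The first component makes the truncated difference the true deficiency, and a positive one.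
  Bounded : List Var → List Row → Set
  Bounded vs F = length vs < length F ×
                 Any (λ w → deg F w ≤ N (length F ∸ length vs)) vs

  bounded? : ∀ vs F → Dec (Bounded vs F)
  bounded? vs F = (length vs <? length F) ×-dec any? (λ w → deg F w ≤? _) vs

  bounded-mono : ∀ {vs F G} → length F ≡ length G → (∀ w → deg F w ≤ deg G w) →
                 Bounded vs G → Bounded vs F
  bounded-mono eq le (< , any) rewrite eq = < , Any.map (λ {w} → ≤-trans (le w)) any

  bounded-↭ : ∀ {vs ws} F → vs ↭ ws → Bounded vs F → Bounded ws F
  bounded-↭ F vs↭ws (< , any) rewrite ↭-length vs↭ws = < , Any-resp-↭ vs↭ws any

  -- Both signs of v occur, so there are c ≥ 2 clauses; the degree is at most c, and c ≤ `N` (c - 1)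
  -- by `N>k`.
  bounded-singleton : ∀ {F v} → Lean (v ∷ []) F → Bounded (v ∷ []) F
  bounded-singleton {F} {v} lean = go (≤-trans 2≤deg (deg≤length F v)) (deg≤length F v)
    where
    2≤deg : 2 ≤ deg F v
    2≤deg = subst (2 ≤_) (sym (deg-signs F v true))
      (+-mono-≤ (lean⇒litDeg>0 (here refl) lean true) (lean⇒litDeg>0 (here refl) lean false))
    go : ∀ {c} → 2 ≤ c → deg F v ≤ c → 1 < c × Any (λ w → deg F w ≤ N (c ∸ 1)) (v ∷ [])
    go {suc zero}    (s≤s ()) _
    go {suc (suc j)} 1<c deg≤ = 1<c , here (≤-trans deg≤ (N>k j))

  -- With e occurrences of the frequent sign, the deficiency is e + j before the assignment and
  -- `suc j` after it. The degree of v is at most 2e, and by minimality at most that of w, which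
  -- loses at most e occurrences; `N-split` combines the two bounds.
  bounded-without : ∀ {F v vs b} → 0 < litDeg F v b → litDeg F v (not b) ≤ litDeg F v b →
                    All (λ w → deg F v ≤ deg F w) vs →
                    Bounded vs (without v b F) → Bounded (v ∷ vs) F
  bounded-without {F} {v} {vs} {b} 0<e a≤e min (n<r , any)
    with w , w∈ , degw ← find any = 1+n<c , here deg≤N
    where
    open ≤-Reasoning
    n = length vs
    r = length (without v b F)
    e = litDeg F v b
    j = r ∸ suc n
    r≡ : r ≡ suc n + j
    r≡ = sym (m+[n∸m]≡n n<r)
    1+n<c : suc n < length F
    1+n<c = subst (2 + n ≤_) (trans (+-comm e r) (length-without F v b)) (+-mono-≤ 0<e n<r)
    c∸n≡ : length F ∸ suc n ≡ e + j
    c∸n≡ = ≡-Reasoning.begin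
      length F ∸ suc n          ≡-Reasoning.≡⟨ cong (_∸ suc n) (length-without F v b) ⟨
      (r + e) ∸ suc n           ≡-Reasoning.≡⟨ +-∸-comm e n<r ⟩
      j + e                     ≡-Reasoning.≡⟨ +-comm j e ⟩
      e + j                     ≡-Reasoning.∎
    r∸n≡ : r ∸ n ≡ suc j
    r∸n≡ = trans (cong (_∸ n) (trans r≡ (sym (+-suc n j)))) (m+n∸m≡n n (suc j))
    deg≤N : deg F v ≤ N (length F ∸ suc n)
    deg≤N = subst (λ k → deg F v ≤ N k) (sym c∸n≡) (N-split 0<e
      (begin
        deg F v                  ≡⟨ deg-signs F v b ⟩
        e + litDeg F v (not b)   ≤⟨ +-monoʳ-≤ e (≤-trans a≤e (m≤m+n e 0)) ⟩
        2 * e                    ∎)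
      (begin
        deg F v                          ≤⟨ All.lookup min w∈ ⟩
        deg F w                          ≤⟨ deg-without F v b w ⟩
        deg (without v b F) w + e        ≤⟨ +-monoˡ-≤ e degw ⟩
        N (r ∸ n) + e                    ≡⟨ cong (λ k → N k + e) r∸n≡ ⟩
        N (suc j) + e                    ∎))

  total : List Var → List Row → ℕ
  total vs F = sum (map (deg F) vs)

  total-mono : ∀ vs F G → (∀ w → deg F w ≤ deg G w) → total vs F ≤ total vs G
  total-mono []       F G le = z≤n
  total-mono (v ∷ vs) F G le = +-mono-≤ (le v) (total-mono vs F G le)

  total≤ : ∀ vs F → total vs F ≤ length vs * length F
  total≤ []       F = z≤n
  total≤ (v ∷ vs) F = +-mono-≤ (deg≤length F v) (total≤ vs F)

  -- Replacing D by D [ v ≔ b ] either flips an occurrence of v or adds one.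
  -- Flips can be repeated only until all clauses contain v with sign b.

  bounded-step :
    ∀ y {F v vs b} → length F ≤ litDeg F v b + y →
    v ∉ vs → Lean (v ∷ vs) F →
    litDeg F v (not b) ≤ litDeg F v b → All (λ w → deg F v ≤ deg F w) vs →
    (∀ {G} → Lean vs G → Bounded vs G) →
    (∀ {G} → length G ≡ length F → total (v ∷ vs) F < total (v ∷ vs) G →
             Lean (v ∷ vs) G → Bounded (v ∷ vs) G) →
    Bounded (v ∷ vs) F
  bounded-step y {F} {v} {vs} {b} c≤ v∉ lean a≤e min IH rec =
    -- An autarky becomes available only by refuting leanness. As `Bounded` is decidable, one may
    -- argue by contradiction: an autarky of the remaining clauses would yield the bound by
    -- `shrink`, so these clauses are lean and `IH` applies to them.
    decidable-stable (bounded? (v ∷ vs) F) λ ¬bounded →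
      ¬bounded (bounded-without {F} {b = b} (lean⇒litDeg>0 (here refl) lean b) a≤e min
        (IH λ (φ , supp , (w , φw) , aut) → ¬bounded (shrink φ supp w φw aut)))
    where
    shrink : ∀ φ → Supported vs φ → ∀ w → φ w ≢ nothing → Autarkic φ (without v b F) →
             Bounded (v ∷ vs) F
    shrink φ supp w φw aut with any? (λ C → ¬? (C w ≟ᵐ nothing) ×-dec ¬? (C v ≟ᵐ just b)) F
    -- If every clause with w contained v with sign b, then w would have degree at most
    -- `litDeg F v b`. This is less than the degree of v, whose other sign occurs too, against
    -- minimality.
    ... | no none = contradiction
          (≤-trans (All.lookup min (supp w φw)) (deg≤litDeg λ {C} C∈ Cw →
            decidable-stable (C v ≟ᵐ just b) λ Cv → none (lose C∈ (Cw , Cv))))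
          (<⇒≱ (subst (litDeg F v b <_) (sym (deg-signs F v b))
            (m<m+n _ (lean⇒litDeg>0 (here refl) lean (not b)))))
    -- The clause `D` survives the assignment and is touched by φ at w, as `lean-≔` requires.
    ... | yes some with D , D∈ , Dw , Dv ← find some with G , F↭ ← ∈⇒↭ D∈ = replace F↭ Dw Dv
      where
      replace : ∀ {D G} → F ↭ D ∷ G → D w ≢ nothing → D v ≢ just b → Bounded (v ∷ vs) F
      replace {D} {G} F↭ Dw Dv = bounded-mono {F = F} {G = D [ v ≔ b ] ∷ G} (↭-length F↭) deg≤ bounded
        where
        D′v : (D [ v ≔ b ]) v ≡ just b
        D′v = ≔-same D v b

        lean′ : Lean (v ∷ vs) (D [ v ≔ b ] ∷ G)
        lean′ = lean-≔ v∉ (lean-⊆ (λ u∈ → u∈) (∈-resp-↭ F↭) lean) supp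
          (λ C C∈ → aut C (∈-resp-↭ (filter-↭ (λ C → ¬? (C v ≟ᵐ just b)) (↭-sym F↭)) C∈))
          (w , φw , Dw)

        deg-other : ∀ {u} → u ≢ v → deg F u ≡ deg (D [ v ≔ b ] ∷ G) u
        deg-other {u} u≢v = trans (deg-↭ u F↭) (deg-∷-cong {G} {D} {D [ v ≔ b ]} (sym (≔-other D b u≢v)))

        deg-v : deg (D [ v ≔ b ] ∷ G) v ≡ suc (deg G v)
        deg-v = deg-∷-occ {G} {D [ v ≔ b ]} (just≢nothing D′v)

        deg≤ : ∀ u → deg F u ≤ deg (D [ v ≔ b ] ∷ G) u
        deg≤ u with toSum (u ≟ v)
        ... | inj₂ u≢v  = ≤-reflexive (deg-other u≢v)
        ... | inj₁ refl = begin
          deg F v                    ≡⟨ deg-↭ v F↭ ⟩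
          deg (D ∷ G) v              ≤⟨ deg-∷-≤ ⟩
          suc (deg G v)              ≡⟨ deg-v ⟨
          deg (D [ v ≔ b ] ∷ G) v    ∎
          where
          open ≤-Reasoning
          deg-∷-≤ : deg (D ∷ G) v ≤ suc (deg G v)
          deg-∷-≤ with D v ≟ᵐ nothing
          ... | yes _ = n≤1+n _
          ... | no  _ = ≤-refl

        bounded : Bounded (v ∷ vs) (D [ v ≔ b ] ∷ G)
        bounded with D v ≟ᵐ nothing
        -- An occurrence of v is added. Now v may no longer have minimal degree, so the argument
        -- restarts through `rec` with a larger total.
        ... | yes Dv≡ =
          rec (sym (↭-length F↭)) (+-mono-<-≤ deg< (total-mono vs F (D [ v ≔ b ] ∷ G) deg≤)) lean′
          where
          deg< : deg F v < deg (D [ v ≔ b ] ∷ G) v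
          deg< = ≤-reflexive (trans (cong suc (trans (deg-↭ v F↭) (deg-∷-not {G} {D} Dv≡))) (sym deg-v))
        -- A sign is flipped. All degrees stay the same, so v is still minimal and `IH` and `rec`
        -- carry over, while y drops by one.
        ... | no Dv≢ = flip y c≤
          where
          deg≡ : ∀ u → deg F u ≡ deg (D [ v ≔ b ] ∷ G) u
          deg≡ u with toSum (u ≟ v)
          ... | inj₂ u≢v  = deg-other u≢v
          ... | inj₁ refl = trans (deg-↭ v F↭) (trans (deg-∷-occ {G} {D} Dv≢) (sym deg-v))

          litDeg≡ : litDeg (D [ v ≔ b ] ∷ G) v b ≡ suc (litDeg F v b)
          litDeg≡ = trans (litDeg-∷-yes {G} {D [ v ≔ b ]} D′v)
            (cong suc (sym (trans (litDeg-↭ v b F↭) (litDeg-∷-no {G} {D} Dv))))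

          litDeg≤ : litDeg (D [ v ≔ b ] ∷ G) v (not b) ≤ litDeg (D [ v ≔ b ] ∷ G) v b
          litDeg≤ = begin
            litDeg (D [ v ≔ b ] ∷ G) v (not b) ≡⟨ litDeg-∷-no {G} {D [ v ≔ b ]} D′v≢ ⟩
            litDeg G v (not b)                 ≤⟨ litDeg-≤-∷ ⟩
            litDeg (D ∷ G) v (not b)           ≡⟨ litDeg-↭ v (not b) F↭ ⟨
            litDeg F v (not b)                 ≤⟨ m≤n⇒m≤1+n a≤e ⟩
            suc (litDeg F v b)                 ≡⟨ litDeg≡ ⟨
            litDeg (D [ v ≔ b ] ∷ G) v b       ∎
            where
            open ≤-Reasoning
            D′v≢ : (D [ v ≔ b ]) v ≢ just (not b)
            D′v≢ eq = Bool.not-¬ refl (just-injective (trans (sym D′v) eq))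
            litDeg-≤-∷ : litDeg G v (not b) ≤ litDeg (D ∷ G) v (not b)
            litDeg-≤-∷ with D v ≟ᵐ just (not b)
            ... | yes _ = n≤1+n _
            ... | no  _ = ≤-refl

          flip : ∀ y → length F ≤ litDeg F v b + y → Bounded (v ∷ vs) (D [ v ≔ b ] ∷ G)
          -- With y = 0 every clause already contains v with sign b, so one more such occurrence is
          -- impossible.
          flip zero c≤ = contradiction
            (begin
              suc (litDeg F v b)            ≡⟨ litDeg≡ ⟨
              litDeg (D [ v ≔ b ] ∷ G) v b  ≤⟨ length-filter (λ C → C v ≟ᵐ just b) (D [ v ≔ b ] ∷ G) ⟩
              suc (length G)                ≡⟨ ↭-length F↭ ⟨
              length F                      ≤⟨ c≤ ⟩
              litDeg F v b + 0              ≡⟨ +-identityʳ _ ⟩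
              litDeg F v b                  ∎)
            1+n≰n
            where open ≤-Reasoning
          flip (suc y) c≤ = bounded-step y
            (subst₂ _≤_ (↭-length F↭) (trans (+-suc _ y) (cong (_+ y) (sym litDeg≡))) c≤)
            v∉ lean′ litDeg≤
            (All.map (λ {u} → subst₂ _≤_ (deg≡ v) (deg≡ u)) min)
            IH
            (λ {H} len tot → rec (trans len (sym (↭-length F↭)))
              (subst (_< total (v ∷ vs) H) (sym total≡) tot))
            where
            total≡ : total (v ∷ vs) F ≡ total (v ∷ vs) (D [ v ≔ b ] ∷ G)
            total≡ = cong sum (map-cong deg≡ (v ∷ vs))

  larger-sign : ∀ F v → ∃ λ b → litDeg F v (not b) ≤ litDeg F v b
  larger-sign F v with ≤-total (litDeg F v true) (litDeg F v false)
  ... | inj₁ le = false , le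
  ... | inj₂ le = true , le

  minimal-first : ∀ F {vs} → 0 < length vs →
                  ∃₂ λ v ws → vs ↭ v ∷ ws × All (λ w → deg F v ≤ deg F w) ws
  minimal-first F {x ∷ xs} _ with v , v∈ , min ← ∃-argmin (deg F) x xs with ws , perm ← ∈⇒↭ v∈ =
    v , ws , perm , All.tail (All-resp-↭ perm min)

  -- The fuel z bounds the number of occurrences that can still be added, since each listed variable
  -- has degree at most `length F`. Each restart keeps `length F` and strictly raises the total.
  saturate : ∀ z {vs F} →
             (∀ {ws G} → suc (length ws) ≡ length vs → 0 < length ws →
              Unique ws → Lean ws G → Bounded ws G) →
             length vs * length F ≤ total vs F + z →
             0 < length vs → Unique vs → Lean vs F → Bounded vs F
  saturate z {vs} {F} IH fuel 0<n uniq lean with minimal-first F 0<n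
  ... | v , [] , perm , _ =
    bounded-↭ F (↭-sym perm) (bounded-singleton {F} (lean-⊆ (∈-resp-↭ (↭-sym perm)) (λ C∈ → C∈) lean))
  ... | v , ws@(_ ∷ _) , perm , min
    with b , a≤e ← larger-sign F v
       | fresh ∷ uniq′ ← Permutationₛ.Unique-resp-↭ (setoid Var) (↭⇒↭ₛ perm) uniq =
    bounded-↭ F (↭-sym perm) (bounded-step (length F) {F} {v} {ws} {b} (m≤n+m _ _)
      (λ v∈ → All.lookup fresh v∈ refl)
      (lean-⊆ (∈-resp-↭ (↭-sym perm)) (λ C∈ → C∈) lean) a≤e min
      (IH (sym (↭-length perm)) (s≤s z≤n) uniq′)
      (λ {G} len tot leanG → bounded-↭ G perm
        (again z fuel len (subst₂ _<_ (sum-↭ (map⁺ _ (↭-sym perm))) (sum-↭ (map⁺ _ (↭-sym perm))) tot)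
          (lean-⊆ (∈-resp-↭ perm) (λ C∈ → C∈) leanG))))
    where
    again : ∀ z {G} → length vs * length F ≤ total vs F + z → length G ≡ length F →
            total vs F < total vs G → Lean vs G → Bounded vs G
    again zero {G} fuel len tot leanG = contradiction
      (begin
        suc (total vs F)      ≤⟨ tot ⟩
        total vs G            ≤⟨ total≤ vs G ⟩
        length vs * length G  ≡⟨ cong (length vs *_) len ⟩
        length vs * length F  ≤⟨ fuel ⟩
        total vs F + 0        ≡⟨ +-identityʳ _ ⟩
        total vs F            ∎) 1+n≰n
      where open ≤-Reasoning
    again (suc z) {G} fuel len tot leanG = saturate z IH
      (begin
        length vs * length G   ≡⟨ cong (length vs *_) len ⟩
        length vs * length F   ≤⟨ fuel ⟩
        total vs F + suc z     ≡⟨ +-suc _ z ⟩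
        suc (total vs F) + z   ≤⟨ +-monoˡ-≤ z tot ⟩
        total vs G + z         ∎)
      0<n uniq leanG
      where open ≤-Reasoning

  -- Outer induction on the number of variables; the whole product `length vs * length F` is enough
  -- fuel to begin with.
  lean⇒bounded : ∀ n {vs F} → length vs ≡ suc n → Unique vs → Lean vs F → Bounded vs F
  lean⇒bounded n {vs} {F} len = saturate (length vs * length F) (smaller n len) (m≤n+m _ _)
    (subst (0 <_) (sym len) (s≤s z≤n))
    where
    smaller : ∀ n → length vs ≡ suc n → ∀ {ws G} → suc (length ws) ≡ length vs → 0 < length ws →
              Unique ws → Lean ws G → Bounded ws G
    smaller zero    len eq 0<ws = contradiction (subst (0 <_) (suc-injective (trans eq len)) 0<ws) λ ()
    smaller (suc n) len eq _    = lean⇒bounded n (suc-injective (trans eq len))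

-- From clause-sets to rows: the upper bound

length-filter-map-≤ : ∀ {a b p q} {A : Set a} {B : Set b} {P : Pred A p} {Q : Pred B q}
                      (P? : Decidable P) (Q? : Decidable Q) {f : A → B} →
                      (∀ x → P x → Q (f x)) → ∀ xs →
                      length (filter P? xs) ≤ length (filter Q? (map f xs))
length-filter-map-≤ P? Q? h [] = z≤n
length-filter-map-≤ P? Q? {f} h (x ∷ xs) with P? x | Q? (f x)
... | yes _ | yes _ = s≤s (length-filter-map-≤ P? Q? h xs)
... | yes p | no ¬q = contradiction (h x p) ¬q
... | no _  | yes _ = m≤n⇒m≤1+n (length-filter-map-≤ P? Q? h xs)
... | no _  | no _  = length-filter-map-≤ P? Q? h xs

minimumℕ-≤ : ∀ {x xs} → x ∈ xs → minimumℕ xs ≤ x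
minimumℕ-≤ {xs = y ∷ ys} (here refl) = min≤v⁺ y ys (inj₁ ≤-refl)
minimumℕ-≤ {xs = y ∷ ys} (there x∈)  = min≤v⁺ y ys (inj₂ (Any.map (λ eq → ≤-reflexive (sym eq)) x∈))

module UpperBound (U : Universe) where
  open Universe U
  open ClauseSets U
  open Rows _≟_
  open DecMembership _≟ˡ_ using () renaming (_∈?_ to _∈ˡ?_)

  literal : Var → Bool → Lit
  literal v true  = pos v
  literal v false = neg v

  row : Clause → Row
  row C v with pos v ∈ˡ? lits C | neg v ∈ˡ? lits C
  ... | yes _ | _     = just true
  ... | no _  | yes _ = just false
  ... | no _  | no _  = nothing

  row-literal : ∀ C v b → literal v b ∈ lits C → row C v ≡ just b
  row-literal C v b l∈ with pos v ∈ˡ? lits C | neg v ∈ˡ? lits C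
  row-literal C v true  l∈ | yes _ | _     = refl
  row-literal C v false l∈ | yes p | _     = contradiction l∈ (consistent C p)
  row-literal C v true  l∈ | no ¬p | _     = contradiction l∈ ¬p
  row-literal C v false l∈ | no _  | yes _ = refl
  row-literal C v false l∈ | no _  | no ¬n = contradiction l∈ ¬n

  literal-row : ∀ C v b → row C v ≡ just b → literal v b ∈ lits C
  literal-row C v b eq with pos v ∈ˡ? lits C | neg v ∈ˡ? lits C
  literal-row C v true  refl | yes p | _     = p
  literal-row C v false refl | no _  | yes n = n

  row-occurs : ∀ C {l} → l ∈ lits C → row C (var l) ≢ nothing
  row-occurs C {pos v} l∈ = just≢nothing (row-literal C v true l∈)
  row-occurs C {neg v} l∈ = just≢nothing (row-literal C v false l∈)

  rows : ClauseSet → List Row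
  rows F = map row (clauses F)

  vdeg≤deg : ∀ F v → vdeg F v ≤ deg (rows F) v
  vdeg≤deg F v = subst (vdeg F v ≤_) (sym (deg-signs (rows F) v true))
    (+-mono-≤ (length-filter-map-≤ _ _ (λ C → row-literal C v true) (clauses F))
              (length-filter-map-≤ _ _ (λ C → row-literal C v false) (clauses F)))

  -- A falsified literal is in particular touched, and the common sign supplied by `Sat` names a
  -- literal of the clause made true.
  LEAN⇒lean : ∀ F → LEAN F → Lean (vars F) (rows F)
  LEAN⇒lean F LF (φ , supp , (u , φu) , aut) =
    LF (ψ , All.tabulate sat , u , in-dom φu , supp u φu)
    where
    φ? : ∀ w → Dec (φ w ≢ nothing)
    φ? w = ¬? (φ w ≟ᵐ nothing)

    ψ : PartialAssignment
    -- The default `true` is only taken outside the domain.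
    ψ = record { dom = filter φ? (vars F) ; val = λ w → fromMaybe true (φ w) }

    in-dom : ∀ {w} → φ w ≢ nothing → w ∈ dom ψ
    in-dom {w} φw = ∈-filter⁺ φ? (supp w φw) φw

    satisfies : ∀ {w b} → φ w ≡ just b → Satisfiesˡ ψ (literal w b)
    satisfies {w} {true}  φw = in-dom (just≢nothing φw) , cong (fromMaybe true) φw
    satisfies {w} {false} φw = in-dom (just≢nothing φw) , cong (λ m → not (fromMaybe true m)) φw

    sat : ∀ {C} → C ∈ clauses F → FalsifiesSomeᶜ ψ C → Satisfiesᶜ ψ C
    sat {C} C∈ false∈ with l , l∈ , (v∈ , _) ← find false∈ with _ , φv ← ∈-filter⁻ φ? {xs = vars F} v∈
      with w , b , φw , Cw ← aut (row C) (∈-map⁺ row C∈) (var l , φv , row-occurs C l∈) =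
      lose (literal-row C w b Cw) (satisfies φw)

  minvdeg-bound : ∀ F → LEAN F → 0 < n F → n F < c F × minvdeg F ≤ N (c F ∸ n F)
  minvdeg-bound F LF 0<n
    with n<c , any ← lean⇒bounded (pred (n F)) (sym (suc-pred (n F) {{>-nonZero 0<n}}))
                       (Unique.deduplicate-! _≟_ _) (LEAN⇒lean F LF)
    with v , v∈ , deg≤ ← find any rewrite length-map row (clauses F) =
    n<c , ≤-trans (minimumℕ-≤ (∈-map⁺ (vdeg F) v∈)) (≤-trans (vdeg≤deg F v) deg≤)

-- Counting, minima and sublists

unique∧set⇒length≡ : ∀ {a} {A : Set a} {xs ys : List A} →
                     Unique xs → Unique ys → xs ∼[ set ] ys → length xs ≡ length ys
unique∧set⇒length≡ uxs uys eq = ↭-length (∼bag⇒↭ (unique∧set⇒bag uxs uys eq))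

length-filter-∷ : ∀ {a p} {A : Set a} {P : Pred A p} (P? : Decidable P) x xs →
                  length (filter P? xs) ≤ length (filter P? (x ∷ xs))
length-filter-∷ P? x xs with P? x
... | yes _ = n≤1+n _
... | no _  = ≤-refl

length-≤-filter-⊎ : ∀ {a p q} {A : Set a} {P : Pred A p} {Q : Pred A q}
                    (P? : Decidable P) (Q? : Decidable Q) {xs} → All (λ x → P x ⊎ Q x) xs →
                    length xs ≤ length (filter P? xs) + length (filter Q? xs)
length-≤-filter-⊎ P? Q? [] = z≤n
length-≤-filter-⊎ P? Q? {x ∷ xs} (px⊎qx ∷ rest) with P? x | Q? x | length-≤-filter-⊎ P? Q? rest
... | yes _ | yes _ | ih = s≤s (≤-trans ih (+-monoʳ-≤ (length (filter P? xs)) (n≤1+n _)))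
... | yes _ | no _  | ih = s≤s ih
... | no _  | yes _ | ih = ≤-trans (s≤s ih) (≤-reflexive (sym (+-suc _ _)))
length-≤-filter-⊎ P? Q? (inj₁ px ∷ _) | no ¬px | no _ | _ = contradiction px ¬px
length-≤-filter-⊎ P? Q? (inj₂ qx ∷ _) | no _ | no ¬qx | _ = contradiction qx ¬qx

≤-minimumℕ : ∀ {m xs} → 0 < length xs → All (m ≤_) xs → m ≤ minimumℕ xs
≤-minimumℕ {xs = x ∷ xs} _ (m≤x ∷ m≤xs) = v≤min⁺ {xs = xs} m≤x m≤xs

minimumℤ-≡ : ∀ {i is} → i ∈ is → All (i ℤ.≤_) is → minimumℤ is ≡ i
minimumℤ-≡ {i} {j ∷ js} i∈ (i≤j ∷ i≤js) = ℤ.≤-antisym (Min.min≤v⁺ j js (≤i i∈)) (Min.v≤min⁺ i≤j i≤js)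
  where
  module Min = Extrema ℤ.≤-totalOrder
  ≤i : i ∈ j ∷ js → j ℤ.≤ i ⊎ Any (ℤ._≤ i) js
  ≤i (here refl) = inj₁ ℤ.≤-refl
  ≤i (there i∈)  = inj₂ (Any.map (λ eq → ℤ.≤-reflexive (sym eq)) i∈)

∈-nonemptySublists : ∀ {a} {A : Set a} (xs : List A) → 0 < length xs → xs ∈ nonemptySublists xs
∈-nonemptySublists (x ∷ [])     _ = here refl
∈-nonemptySublists (x ∷ y ∷ xs) _ =
  there (∈-++⁺ˡ (∈-map⁺ (x ∷_) (∈-nonemptySublists (y ∷ xs) (s≤s z≤n))))

sublist-proper : ∀ {a} {A : Set a} {xs V : List A} → V ∈ nonemptySublists xs →
                 V ≡ xs ⊎ length V < length xs
sublist-proper {xs = x ∷ []}     (here refl) = inj₁ refl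
sublist-proper {xs = x ∷ y ∷ xs} (here refl) = inj₂ (s≤s (s≤s z≤n))
sublist-proper {xs = x ∷ xs}     (there V∈) with ∈-++⁻ (map (x ∷_) (nonemptySublists xs)) V∈
... | inj₂ V∈xs with sublist-proper V∈xs
...   | inj₁ refl = inj₂ ≤-refl
...   | inj₂ V<   = inj₂ (m≤n⇒m≤1+n V<)
sublist-proper {xs = x ∷ xs}     (there V∈) | inj₁ V∈x∷ with _ , V∈xs , refl ← ∈-map⁻ (x ∷_) V∈x∷
  with sublist-proper V∈xs
... | inj₁ refl = inj₁ refl
... | inj₂ V<   = inj₂ (s≤s V<)

sublist-member : ∀ {a} {A : Set a} {xs V : List A} → V ∈ nonemptySublists xs →
                 ∃ λ x → x ∈ V × x ∈ xs
sublist-member {xs = x ∷ xs} (here refl) = x , here refl , here refl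
sublist-member {xs = x ∷ xs} (there V∈) with ∈-++⁻ (map (x ∷_) (nonemptySublists xs)) V∈
... | inj₁ V∈x∷ with _ , _ , refl ← ∈-map⁻ (x ∷_) V∈x∷ = x , here refl , here refl
... | inj₂ V∈xs with y , y∈V , y∈xs ← sublist-member V∈xs = y , y∈V , there y∈xs

-- Extremal clause-sets: the lower bound

module LowerBound (U : Universe) where
  open Universe U
  open ClauseSets U
  open DecMembership _≟_ using () renaming (_∈?_ to _∈ᵛ?_)
  open DecMembership _≟ˡ_ using () renaming (_∈?_ to _∈ˡ?_)

  distinct-variables : ∀ m → ∃ λ vs → length vs ≡ m × Unique vs
  distinct-variables zero = [] , refl , []
  distinct-variables (suc m) with vs , len , uniq ← distinct-variables m with v , v∉ ← fresh vs =
    v ∷ vs , cong suc len , All.tabulate (λ { u∈ refl → v∉ u∈ }) ∷ uniq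

  comp≢ : ∀ l → comp l ≢ l
  comp≢ (pos _) ()
  comp≢ (neg _) ()

  var-comp : ∀ l → var (comp l) ≡ var l
  var-comp (pos _) = refl
  var-comp (neg _) = refl

  unique⇒consistent : ∀ {ls} → Unique (map var ls) → ∀ {l} → l ∈ ls → comp l ∉ ls
  unique⇒consistent _          {l} (here refl) (here eq)  = comp≢ l eq
  unique⇒consistent (x∉ ∷ _)   {l} (here refl) (there c∈) =
    All.lookup x∉ (subst (_∈ _) (var-comp l) (∈-map⁺ var c∈)) refl
  unique⇒consistent (x∉ ∷ _)   {l} (there l∈)  (here refl) =
    All.lookup x∉ (∈-map⁺ var l∈) (var-comp l)
  unique⇒consistent (_ ∷ uniq) (there l∈) (there c∈) = unique⇒consistent uniq l∈ c∈

  signings : List Var → List (List Lit)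
  signings []       = [] ∷ []
  signings (v ∷ vs) = map (pos v ∷_) (signings vs) ++ map (neg v ∷_) (signings vs)

  length-signings : ∀ vs → length (signings vs) ≡ 2 ^ length vs
  length-signings []       = refl
  length-signings (v ∷ vs) = trans (length-++ (map (pos v ∷_) S))
    (cong₂ _+_ (trans (length-map _ S) (length-signings vs))
               (trans (length-map _ S) (trans (length-signings vs) (sym (+-identityʳ _)))))
    where S = signings vs

  signings-vars : ∀ vs → All (λ s → map var s ≡ vs) (signings vs)
  signings-vars []       = refl ∷ []
  signings-vars (v ∷ vs) = All.++⁺ (All.map⁺ (All.map (cong (v ∷_)) (signings-vars vs)))
                                   (All.map⁺ (All.map (cong (v ∷_)) (signings-vars vs)))

  -- A clash shows that two clauses differ as sets, because clauses are consistent. It survives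
  -- prepending literals, so it is carried through the construction in place of set inequality.
  Clash : List Lit → List Lit → Set
  Clash a b = ∃ λ l → l ∈ a × comp l ∈ b

  clash-∷ : ∀ l {S} → AllPairs Clash S → AllPairs Clash (map (l ∷_) S)
  clash-∷ l = AllPairs.map⁺ ∘ AllPairs.map λ (k , k∈a , k∈b) → k , there k∈a , there k∈b

  clash-heads : ∀ l S T → All (λ a → All (Clash a) (map (comp l ∷_) T)) (map (l ∷_) S)
  clash-heads l S T = All.map⁺ (All.universal (λ _ →
    All.map⁺ (All.universal (λ _ → l , here refl , here refl) T)) S)

  signings-clash : ∀ vs → AllPairs Clash (signings vs)
  signings-clash []       = [] ∷ []
  signings-clash (v ∷ vs) = AllPairs.++⁺ (clash-∷ _ ih) (clash-∷ _ ih)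
    (clash-heads (pos v) (signings vs) (signings vs))
    where ih = signings-clash vs

  -- At each variable take the sign that `val φ` makes false.
  falsified-signing : ∀ φ vs → ∃ λ s → s ∈ signings vs × All (λ l → value φ l ≡ false) s
  falsified-signing φ []       = [] , here refl , []
  falsified-signing φ (v ∷ vs) with s , s∈ , false-s ← falsified-signing φ vs with val φ v in eq
  ... | true  = neg v ∷ s , ∈-++⁺ʳ _ (∈-map⁺ _ s∈) , cong not eq ∷ false-s
  ... | false = pos v ∷ s , ∈-++⁺ˡ (∈-map⁺ _ s∈) , eq ∷ false-s

  WellFormed : List Lit → Set
  WellFormed ls = Unique (map var ls)

  toClause : ∀ {ls} → WellFormed ls → Clause
  toClause {ls} wf = record { lits = ls ; consistent = unique⇒consistent wf }

  toClauses : ∀ {Ls} → All WellFormed Ls → List Clause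
  toClauses = All.reduce toClause

  lits-toClauses : ∀ {Ls} (wfs : All WellFormed Ls) → map lits (toClauses wfs) ≡ Ls
  lits-toClauses []         = refl
  lits-toClauses (wf ∷ wfs) = cong (_ ∷_) (lits-toClauses wfs)

  clash⇒≁ : ∀ C D → Clash (lits C) (lits D) → ¬ lits C ∼[ set ] lits D
  clash⇒≁ C D (l , l∈C , l̄∈D) C∼D = consistent D (Equivalence.to C∼D l∈C) l̄∈D

  ∈-vars⁺ : ∀ {F C v} → C ∈ clauses F → v ∈ varsᶜ C → v ∈ vars F
  ∈-vars⁺ C∈ v∈ = ∈-deduplicate⁺ _≟_ (∈-concatMap⁺ varsᶜ (lose C∈ v∈))

  ∈-vars⁻ : ∀ {F v} → v ∈ vars F → ∃ λ C → C ∈ clauses F × v ∈ varsᶜ C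
  ∈-vars⁻ {F} v∈ = find (∈-concatMap⁻ varsᶜ {xs = clauses F} (∈-deduplicate⁻ _≟_ _ v∈))

  module Extremal (x y : Var) (ys : List Var) (uniq : Unique (x ∷ y ∷ ys))
                  (j : ℕ) (j≤ : j ≤ 2 ^ length (y ∷ ys)) where

    vs : List Var
    vs = x ∷ y ∷ ys

    -- The clauses with `neg x` give unsatisfiability once x is forced to be true; the number j of
    -- clauses with `pos x` tunes the deficiency.
    S fullLits : List (List Lit)
    S = signings (y ∷ ys)
    fullLits = map (neg x ∷_) S ++ map (pos x ∷_) (take j S)

    fullLits-vars : All (λ ls → map var ls ≡ vs) fullLits
    fullLits-vars = All.++⁺ (All.map⁺ (All.map (cong (x ∷_)) (signings-vars (y ∷ ys))))
      (All.map⁺ (All.take⁺ j (All.map (cong (x ∷_)) (signings-vars (y ∷ ys)))))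

    fullLits-clash : AllPairs Clash fullLits
    fullLits-clash = AllPairs.++⁺ (clash-∷ _ (signings-clash (y ∷ ys)))
      (clash-∷ _ (AllPairs.take⁺ j (signings-clash (y ∷ ys)))) (clash-heads (neg x) S (take j S))

    wf : All WellFormed fullLits
    wf = All.map (λ eq → subst Unique (sym eq) uniq) fullLits-vars

    unit : Clause
    unit = toClause {pos x ∷ []} ([] ∷ [])

    full : List Clause
    full = toClauses wf

    full-vars : All (λ C → varsᶜ C ≡ vs) full
    full-vars = All.map⁻ (subst (All _) (sym (lits-toClauses wf)) fullLits-vars)

    length-full : length full ≡ 2 ^ length (y ∷ ys) + j
    length-full = begin
      length full ≡⟨ length-map lits full ⟨
      length (map lits full) ≡⟨ cong length (lits-toClauses wf) ⟩
      length fullLits ≡⟨ length-++ (map (neg x ∷_) S) ⟩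
      length (map (neg x ∷_) S) + length (map (pos x ∷_) (take j S))
        ≡⟨ cong₂ _+_ (length-map _ S) (length-map _ (take j S)) ⟩
      length S + length (take j S) ≡⟨ cong (λ m → length S + m) (length-take j S) ⟩
      length S + (j ⊓ length S) ≡⟨ cong (λ m → m + (j ⊓ m)) (length-signings (y ∷ ys)) ⟩
      2 ^ length (y ∷ ys) + (j ⊓ 2 ^ length (y ∷ ys))
        ≡⟨ cong (λ m → 2 ^ length (y ∷ ys) + m) (m≤n⇒m⊓n≡m j≤) ⟩
      2 ^ length (y ∷ ys) + j ∎
      where open ≡-Reasoning

    -- The second variable y occurs in every full clause but not in {x}.
    unit≁full : ∀ {C} → varsᶜ C ≡ vs → ¬ lits unit ∼[ set ] lits C
    unit≁full {C} eq unit∼C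
      with l , l∈ , y≡ ← ∈-map⁻ var (subst (y ∈_) (sym eq) (there (here refl)))
      with Equivalence.from unit∼C l∈
    ... | here refl = All.head (AllPairs.head uniq) (sym y≡)

    F : ClauseSet
    F = record
      { clauses  = unit ∷ full
      ; distinct = All.map (λ {C} → unit≁full {C}) full-vars ∷
                   AllPairs.map (λ {C} {D} → clash⇒≁ C D)
                     (AllPairs.map⁻ (subst (AllPairs Clash) (sym (lits-toClauses wf)) fullLits-clash))
      }

    full-∈ : ∀ {C v} → v ∈ vs → C ∈ full → v ∈ varsᶜ C
    full-∈ v∈ C∈ = subst (_ ∈_) (sym (All.lookup full-vars C∈)) v∈

    0<full : 0 < length full
    0<full = ≤-trans (m^n>0 2 (length (y ∷ ys))) (≤-trans (m≤m+n _ j) (≤-reflexive (sym length-full)))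

    vars∼vs : vars F ∼[ set ] vs
    vars∼vs = mk⇔ to from
      where
      to : ∀ {v} → v ∈ vars F → v ∈ vs
      to v∈ with ∈-vars⁻ {F} v∈
      ... | _ , here refl , here refl = here refl
      ... | _ , there C∈  , v∈C       = subst (_ ∈_) (All.lookup full-vars C∈) v∈C
      member : ∀ {Cs : List Clause} → 0 < length Cs → ∃ λ C → C ∈ Cs
      member {C ∷ _} _ = C , here refl
      from : ∀ {v} → v ∈ vs → v ∈ vars F
      from v∈ with C , C∈ ← member 0<full = ∈-vars⁺ {F} (there C∈) (full-∈ v∈ C∈)

    n-F : n F ≡ length vs
    n-F = unique∧set⇒length≡ {xs = vars F}
      (Unique.deduplicate-! _≟_ (concatMap varsᶜ (clauses F))) uniq vars∼vs

    -- Each full clause contributes one to the degree of every variable.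
    minvdeg-F : length full ≤ minvdeg F
    minvdeg-F = ≤-minimumℕ (subst (0 <_) (sym (trans (length-map (vdeg F) (vars F)) n-F)) (s≤s z≤n))
      (All.map⁺ (All.tabulate λ {v} v∈ → ≤-trans
        (length-≤-filter-⊎ (λ C → pos v ∈ˡ? lits C) (λ C → neg v ∈ˡ? lits C)
          (All.tabulate λ {C} C∈ → sign C (full-∈ (Equivalence.to vars∼vs v∈) C∈)))
        (+-mono-≤ (length-filter-∷ (λ C → pos v ∈ˡ? lits C) unit full)
                  (length-filter-∷ (λ C → neg v ∈ˡ? lits C) unit full))))
      where
      sign : ∀ C {v} → v ∈ varsᶜ C → pos v ∈ lits C ⊎ neg v ∈ lits C
      sign C v∈ with ∈-map⁻ var v∈
      ... | pos _ , l∈ , refl = inj₁ l∈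
      ... | neg _ , l∈ , refl = inj₂ l∈

    x∈clause : ∀ {C} → C ∈ clauses F → x ∈ varsᶜ C
    x∈clause (here refl) = here refl
    x∈clause (there C∈)  = full-∈ (here refl) C∈

    -- Every clause contains x. Hence the set of all variables attains the value `δ F` in the
    -- surplus.
    meeting-vars : clausesMeeting F (vars F) ≡ c F
    meeting-vars = cong length (filter-all (λ C → any? (_∈ᵛ? vars F) (varsᶜ C))
      (All.tabulate λ C∈ → lose (x∈clause C∈) (Equivalence.from vars∼vs (here refl))))

    -- A proper V has at least one variable less, which makes up for {x}, the only clause it can
    -- miss.
    δ≤surplus : ∀ {V} → V ∈ nonemptySublists (vars F) → δ F ℤ.≤ clausesMeeting F V ⊖ length V
    δ≤surplus {V} V∈ with sublist-proper {xs = vars F} V∈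
    ... | inj₁ refl = ℤ.≤-reflexive (cong (_⊖ n F) (sym meeting-vars))
    ... | inj₂ V<   = begin
      suc (length full) ⊖ n F            ≤⟨ ℤ.⊖-monoʳ-≥-≤ (suc (length full)) V< ⟩
      suc (length full) ⊖ suc (length V) ≡⟨ ℤ.[1+m]⊖[1+n]≡m⊖n (length full) (length V) ⟩
      length full ⊖ length V             ≤⟨ ℤ.⊖-monoˡ-≤ (length V) full≤ ⟩
      clausesMeeting F V ⊖ length V      ∎
      where
      open ℤ.≤-Reasoning
      meets? : ∀ C → Dec (Any (_∈ V) (varsᶜ C))
      meets? C = any? (_∈ᵛ? V) (varsᶜ C)
      meets : ∀ {C} → C ∈ full → Any (_∈ V) (varsᶜ C)
      meets C∈ with v , v∈V , v∈ ← sublist-member {xs = vars F} V∈ =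
        lose (full-∈ (Equivalence.to vars∼vs v∈) C∈) v∈V
      full≤ : length full ≤ clausesMeeting F V
      full≤ = ≤-trans (≤-reflexive (cong length (sym (filter-all meets? (All.tabulate meets)))))
                      (length-filter-∷ meets? unit full)

    F∈SED : SED F
    F∈SED = minimumℤ-≡
      (subst (_∈ surpluses) (cong (_⊖ n F) meeting-vars)
        (∈-map⁺ _ (∈-nonemptySublists (vars F) 0<n)))
      (All.map⁺ (All.tabulate δ≤surplus))
      where
      surpluses = map (λ V → clausesMeeting F V ⊖ length V) (nonemptySublists (vars F))
      0<n : 0 < n F
      0<n = subst (0 <_) (sym n-F) (s≤s z≤n)

    satisfies-fullLits : ∀ {φ} → All (Satisfiesᶜ φ) full → All (Any (Satisfiesˡ φ)) fullLits
    satisfies-fullLits sat = subst (All _) (lits-toClauses wf) (All.map⁺ sat)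

    -- The unit clause forces x to be true, and then `neg x` together with the signing that φ
    -- falsifies is a falsified clause.
    F-unsatisfiable : Unsatisfiable F
    F-unsatisfiable (φ , here (_ , φx) ∷ sat-full)
      with s , s∈ , false-s ← falsified-signing φ (y ∷ ys)
      with l , l∈ , (_ , φl) ← find (All.lookup (satisfies-fullLits sat-full) (∈-++⁺ˡ (∈-map⁺ (neg x ∷_) s∈)))
      = contradiction (trans (sym φl) (All.lookup (cong not φx ∷ false-s) l∈)) λ ()

    F-minimal : ∀ F′ → F′ ⊆ᶜ F → Unsatisfiable F′ → vars F′ ∼[ set ] vars F
    F-minimal F′ F′⊆F unsat = mk⇔ to from
      where
      same : ∀ {C D} → C ≡ D → lits C ∼[ set ] lits D
      same refl = mk⇔ id id

      original : ∀ {C} → C ∈ clauses F′ → ∃ λ D → D ∈ clauses F × lits C ∼[ set ] lits D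
      original {C} C∈ = find (F′⊆F {C} (Any.map same C∈))

      varsᶜ-∼ : ∀ {C D v} → (∀ {l} → l ∈ lits C → l ∈ lits D) → v ∈ varsᶜ C → v ∈ varsᶜ D
      varsᶜ-∼ C⊆D v∈ with l , l∈ , refl ← ∈-map⁻ var v∈ = ∈-map⁺ var (C⊆D l∈)

      to : ∀ {v} → v ∈ vars F′ → v ∈ vars F
      to v∈ with C , C∈ , v∈C ← ∈-vars⁻ {F′} v∈ with D , D∈ , C∼D ← original C∈ =
        ∈-vars⁺ {F} D∈ (varsᶜ-∼ {C} {D} (Equivalence.to C∼D) v∈C)

      φ : PartialAssignment
      φ = record { dom = x ∷ [] ; val = λ _ → true }

      from : ∀ {v} → v ∈ vars F → v ∈ vars F′
      -- A subset missing some variable v contains no full clause, so {x} is its only possible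
      -- clause, satisfied by x ↦ true.
      from {v} v∈ = decidable-stable (v ∈ᵛ? vars F′) λ v∉ → unsat (φ , All.tabulate (sat v∉))
        where
        sat : v ∉ vars F′ → ∀ {C} → C ∈ clauses F′ → Satisfiesᶜ φ C
        sat v∉ {C} C∈ with original C∈
        ... | _ , here refl , C∼unit =
          lose (Equivalence.from C∼unit (here refl)) (here refl , refl)
        ... | D , there D∈  , C∼D = contradiction
          (∈-vars⁺ {F′} C∈ (varsᶜ-∼ {D} {C} (Equivalence.from C∼D) (full-∈ (Equivalence.to vars∼vs v∈) D∈))) v∉

    δ-F : δ F ≡ (2 ^ suc (length ys) + j) ⊖ suc (length ys)
    δ-F = begin
      suc (length full) ⊖ n F                          ≡⟨ cong (suc (length full) ⊖_) n-F ⟩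
      suc (length full) ⊖ suc (suc (length ys))        ≡⟨ ℤ.[1+m]⊖[1+n]≡m⊖n (length full) (suc (length ys)) ⟩
      length full ⊖ suc (length ys)                    ≡⟨ cong (_⊖ suc (length ys)) length-full ⟩
      (2 ^ suc (length ys) + j) ⊖ suc (length ys)      ∎
      where open ≡-Reasoning

  -- The clause-sets with l + 1 variables besides x realise all k between
  -- 2^(l+1) − (l+1) and 2^(l+2) − (l+3), where N k ≤ k + l + 1.

  Sharp : ℕ → Set
  Sharp k = ∃ λ F → (VMU F × SED F) × δ F ≡ + k × 0 < n F × N k ≤ minvdeg F

  sharp-over : ∀ k {x y ys} → Unique (x ∷ y ∷ ys) → 2 ^ suc (length ys) ≤ 2 + k + length ys →
               4 + k + length ys ≤ 2 ^ (2 + length ys) → Sharp (suc k)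
  sharp-over k {x} {y} {ys} uniq lo hi =
    F , ((F-unsatisfiable , F-minimal) , F∈SED) , δF≡ , subst (0 <_) (sym n-F) (s≤s z≤n) ,
    ≤-trans (N-upper (length ys) k hi) (≤-trans (≤-reflexive (sym full≡)) minvdeg-F)
    where
    Q = 2 ^ suc (length ys)
    -- This makes `2 + k + length ys` full clauses: the number that gives deficiency `suc k`, and
    -- also the bound on `N (suc k)` from `N-upper`.
    j = 2 + k + length ys ∸ Q
    Q+j≡ : Q + j ≡ 2 + k + length ys
    Q+j≡ = m+[n∸m]≡n lo
    j≤Q : j ≤ Q
    j≤Q = +-cancelˡ-≤ Q j Q (begin
      Q + j                ≡⟨ Q+j≡ ⟩
      2 + k + length ys    ≤⟨ ≤-trans (n≤1+n _) (n≤1+n _) ⟩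
      4 + k + length ys    ≤⟨ hi ⟩
      2 * Q                ≡⟨ cong (λ m → Q + m) (+-identityʳ Q) ⟩
      Q + Q                ∎)
      where open ≤-Reasoning
    open Extremal x y ys uniq j j≤Q
    full≡ : length full ≡ 2 + k + length ys
    full≡ = trans length-full Q+j≡
    δF≡ : δ F ≡ + suc k
    δF≡ = begin
      δ F                                         ≡⟨ δ-F ⟩
      (Q + j) ⊖ suc (length ys)
        ≡⟨ cong (_⊖ suc (length ys)) (trans Q+j≡ (cong suc (sym (+-suc k _)))) ⟩
      (suc k + suc (length ys)) ⊖ suc (length ys) ≡⟨ ℤ.⊖-≥ (m≤n+m (suc (length ys)) (suc k)) ⟩
      + (suc k + suc (length ys) ∸ suc (length ys)) ≡⟨ cong +_ (m+n∸n≡m (suc k) (suc (length ys))) ⟩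
      + suc k                                     ∎
      where open ≡-Reasoning

  sharp : ∀ k → Sharp (suc k)
  sharp k = choose (∃-exponent k)
    where
    over : ∀ {l} → 2 ^ suc l ≤ 2 + k + l → 4 + k + l ≤ 2 ^ (2 + l) →
           (∃ λ vs → length vs ≡ 2 + l × Unique vs) → Sharp (suc k)
    over lo hi (x ∷ y ∷ ys , refl , uniq) = sharp-over k uniq lo hi
    choose : (∃ λ l → 2 ^ suc l ≤ 2 + k + l × 4 + k + l ≤ 2 ^ (2 + l)) → Sharp (suc k)
    choose (l , lo , hi) = over lo hi (distinct-variables (2 + l))

-- The supremum at fixed deficiency

theorem9p14 : ∀ {ℓ} (U : Universe) → let open ClauseSets U in
    (C : Pred ClauseSet ℓ) → C Respects _≈ᶜ_ →
    (VMU ∩ SED) ⊆ C → C ⊆ LEAN →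
    (k : ℕ) → .{{_ : NonZero k}} →
    MinvdegIs (λ F → C F × δ F ≡ + k) [ N k ]
theorem9p14 U C _ VMU∩SED⊆C C⊆LEAN k@(suc m) = record { upper = upper ; least = least }
  where
  open ClauseSets U
  open UpperBound U using (minvdeg-bound)
  open LowerBound U using (Sharp; sharp)

  upper : ∀ F → C F × δ F ≡ + k → 0 < n F → [ minvdeg F ] ≤∞ [ N k ]
  upper F (CF , δF) 0<n with n<c , bound ← minvdeg-bound F (C⊆LEAN CF) 0<n =
    -- As n < c, the truncated difference is the integer deficiency and hence equals k.
    [ subst (λ i → minvdeg F ≤ N i) (ℤ.+-injective (trans (sym (ℤ.⊖-≥ (<⇒≤ n<c))) δF)) bound ]

  least : ∀ t → (∀ F → C F × δ F ≡ + k → 0 < n F → [ minvdeg F ] ≤∞ t) → [ N k ] ≤∞ t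
  least t t-upper = attained (sharp m)
    where
    attained : Sharp k → [ N k ] ≤∞ t
    -- The sharp clause-set lies in C, so every upper bound is at least its minimum degree.
    attained (F , F∈ , δF , 0<n , N≤) = ≤⁺-trans ≤-trans [ N≤ ] (t-upper F (VMU∩SED⊆C F∈ , δF) 0<n)
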